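{- Let $\mathcal{L}$ be a finite relational language. If $U$ is a countable ultraextensive $\mathcal{L}$-structure, then the automorphism group $\mathrm{Aut}(U)$ has a dense locally finite subgroup.
   Context: $\mathrm{Aut}(U)$ carries the topology of pointwise convergence on the discrete set $U$. A group is locally finite if each of its finitely generated subgroups is finite. Basic notions. Substructures are induced substructures; $D$ is an extension of $C$ if $C$ is a substructure of $D$. HL-extensions. A partial isomorphism of an $\mathcal{L}$-structure $C$ is an isomorphism between two finite substructures of $C$. $\mathcal{P}_C$ denotes the set of partial isomorphisms $p$ of $C$ that are not restrictions of the identity map $1_C$. If $C_1\subseteq C_2$ then $\mathcal{P}_{C_1}\subseteq\mathcal{P}_{C_2}$. An HL-extension of $C$ is a pair $(D,\phi)$ where $D$ is an extension of $C$ and $\phi:\mathcal{P}_C\to\mathrm{Aut}(D)$ is such that $\phi(p)$ extends $p$ for all $p\in\mathcal{P}_C$; it is assumed throughout that $\phi(p^{ -1})=\phi(p)^{ -1}$. It is finite if $D$ is finite. It is minimal if for every $b\in D\setminus C$ there are $p_1,\dots,p_n\in\mathcal{P}_C$ and $a\in C$ with $b=\phi(p_1)\cdots\phi(p_n)(a)$. Coherence. Let $C_1\subseteq C_2$ and let $(D_i,\phi_i)$ be an HL-extension of $C_i$, $i=1,2$. They are coherent if (i) $D_2$ extends $D_1$; (ii) $\phi_2(p)$ extends $\phi_1(p)$ for all $p\in\mathcal{P}_{C_1}$; (iii) with $K_i=\langle\phi_i(\mathcal{P}_{C_i})\rangle\le\mathrm{Aut}(D_i)$, the map $\phi_1(p)\mapsto\phi_2(p)$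 ($p\in\mathcal{P}_{C_1}$) has a unique extension to an injective group homomorphism $K_1\to K_2$. Ultraextensive. An $\mathcal{L}$-structure $U$ is ultraextensive if (i) $U$ is ultrahomogeneous, i.e. there is $\phi$ such that $(U,\phi)$ is an HL-extension of $U$; (ii) every finite substructure $C\subseteq U$ has a finite HL-extension $(D,\phi)$ with $D\subseteq U$; (iii) if $C_1\subseteq C_2\subseteq U$ are finite and $(D_1,\phi_1)$ is a finite minimal HL-extension of $C_1$ with $D_1\subseteq U$, then there is a finite minimal HL-extension $(D_2,\phi_2)$ of $C_2$ with $D_2\subseteq U$ such that $(D_1,\phi_1)$ and $(D_2,\phi_2)$ are coherent. -}

module Defs where

open import Level using (Level; 0ℓ; _⊔_) renaming (suc to lsuc)
open import Algebra.Bundles using (Group)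
open import Algebra.Morphism.Structures using (IsGroupMonomorphism)
open import Data.Fin.Base using (Fin)
open import Data.List.Base using (List; foldr; map)
open import Data.List.Relation.Unary.All using (All)
import Data.List.Membership.Setoid as ListMembership
open import Data.Nat.Base using (ℕ)
open import Data.Product.Base using (Σ; ∃; _×_; _,_; proj₁)
open import Data.Product using (∃!)
open import Data.Sum.Base using (_⊎_)
open import Data.Unit.Base using (⊤)
open import Data.Vec.Functional using (Vector)
open import Function.Base using (_∘_)
open import Function.Bundles using (Inverse; _⇔_; mk⇔; Equivalence)
import Function.Construct.Composition as Composition
import Function.Construct.Identity as Identity
import Function.Construct.Symmetry as Symmetry
open import Relation.Binary.Bundles using (Setoid)
open import Relation.Binary.Definitions using (_Respects_)
import Relation.Binary.Construct.On as On
import Relation.Binary.PropositionalEquality as ≡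
open import Relation.Nullary.Negation using (¬_)
open import Relation.Unary using (Pred; Satisfiable; _∩_)

private
  variable
    c ℓ p : Level

IsFinite : Setoid c ℓ → Set (c ⊔ ℓ)
IsFinite S = ∃ λ n → Inverse S (≡.setoid (Fin n))

-- Countable means finite (possibly empty) or countably infinite.
IsCountable : Setoid c ℓ → Set (c ⊔ ℓ)
IsCountable S = IsFinite S ⊎ Inverse S (≡.setoid ℕ)

record Subgroup (G : Group c ℓ) (p : Level) : Set (c ⊔ ℓ ⊔ lsuc p) where
  open Group G
  field
    pred      : Pred Carrier p
    resp      : pred Respects _≈_
    ε-closed  : pred ε
    ∙-closed  : ∀ {x y} → pred x → pred y → pred (x ∙ y)
    ⁻¹-closed : ∀ {x} → pred x → pred (x ⁻¹)

  group : Group (c ⊔ p) ℓ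
  group = record
    { Carrier = Σ Carrier pred
    ; _≈_     = λ x y → proj₁ x ≈ proj₁ y
    ; _∙_     = λ { (x , x∈) (y , y∈) → x ∙ y , ∙-closed x∈ y∈ }
    ; ε       = ε , ε-closed
    ; _⁻¹     = λ { (x , x∈) → x ⁻¹ , ⁻¹-closed x∈ }
    ; isGroup = record
      { isMonoid = record
        { isSemigroup = record
          { isMagma = record
            { isEquivalence = On.isEquivalence proj₁ isEquivalence
            ; ∙-cong        = ∙-cong
            }
          ; assoc = λ x y z → assoc (proj₁ x) (proj₁ y) (proj₁ z)
          }
        ; identity = (λ x → identityˡ (proj₁ x)) , (λ x → identityʳ (proj₁ x))
        }
      ; inverse = (λ x → inverseˡ (proj₁ x)) , (λ x → inverseʳ (proj₁ x))
      ; ⁻¹-cong = ⁻¹-cong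
      }
    }

module _ (G : Group c ℓ) where
  open Group G

  data Generated (S : Pred Carrier p) : Pred Carrier (c ⊔ ℓ ⊔ p) where
    gen  : ∀ {x} → S x → Generated S x
    unit : Generated S ε
    mul  : ∀ {x y} → Generated S x → Generated S y → Generated S (x ∙ y)
    inv  : ∀ {x} → Generated S x → Generated S (x ⁻¹)
    eq   : ∀ {x y} → x ≈ y → Generated S x → Generated S y

  ⟨_⟩ : Pred Carrier p → Subgroup G (c ⊔ ℓ ⊔ p)
  ⟨ S ⟩ = record
    { pred      = Generated S
    ; resp      = eq
    ; ε-closed  = unit
    ; ∙-closed  = mul
    ; ⁻¹-closed = inv
    }

  LocallyFinite : Set (c ⊔ ℓ)
  LocallyFinite =
    ∀ (xs : List Carrier) →
    IsFinite (Group.setoid (Subgroup.group ⟨ (λ x → x ∈ xs) ⟩))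
    where open ListMembership setoid using (_∈_)

record Language : Set₁ where
  field
    Symbol : Set
    arity  : Symbol → ℕ

IsFiniteLanguage : Language → Set
IsFiniteLanguage L = IsFinite (≡.setoid (Language.Symbol L))

module _ {L : Language} where
  open Language L

  record Structure : Set₁ where
    field
      setoid : Setoid 0ℓ 0ℓ
    open Setoid setoid public using (Carrier; _≈_)
    field
      Rel      : (s : Symbol) → Pred (Vector Carrier (arity s)) 0ℓ
      Rel-resp : ∀ s {xs ys} → (∀ i → xs i ≈ ys i) → Rel s xs → Rel s ys

  record Subset (M : Structure) : Set₁ where
    open Structure M
    field
      pred : Pred Carrier 0ℓ
      resp : pred Respects _≈_

  infix 4 _∈_ _⊆_
  infixl 8 _↾_

  _∈_ : {M : Structure} → Structure.Carrier M → Subset M → Set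
  x ∈ C = Subset.pred C x

  _⊆_ : {M : Structure} → Subset M → Subset M → Set
  C ⊆ D = ∀ {x} → x ∈ C → x ∈ D

  -- A record rather than a Σ-type, so that C can be inferred from U ↾ C.
  record Element {M : Structure} (C : Subset M) : Set where
    constructor elem
    field
      value  : Structure.Carrier M
      member : value ∈ C
  open Element

  full : (M : Structure) → Subset M
  full M = record { pred = λ _ → ⊤ ; resp = λ _ t → t }

  _↾_ : (M : Structure) → Subset M → Structure
  M ↾ C = record
    { setoid   = On.setoid {B = Element C} setoid value
    ; Rel      = λ s xs → Rel s (value ∘ xs)
    ; Rel-resp = λ s → Rel-resp s
    }
    where open Structure M

  IsFiniteStructure : Structure → Set
  IsFiniteStructure M = IsFinite (Structure.setoid M)

  infix 4 _≅_

  record _≅_ (M N : Structure) : Set where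
    private
      module M = Structure M
      module N = Structure N
    field
      bij       : Inverse M.setoid N.setoid
    open Inverse bij public using (to; from; to-cong; from-cong)
    field
      preserves : ∀ s xs → M.Rel s xs ⇔ N.Rel s (to ∘ xs)

  ≅-refl : ∀ {M} → M ≅ M
  ≅-refl {M} = record
    { bij       = Identity.inverse (Structure.setoid M)
    ; preserves = λ _ _ → mk⇔ (λ r → r) (λ r → r)
    }

  ≅-sym : ∀ {M N} → M ≅ N → N ≅ M
  ≅-sym {M} {N} f = record
    { bij       = Symmetry.inverse f.bij
    ; preserves = λ s ys →
        let to∘from = λ i → Inverse.strictlyInverseˡ f.bij (ys i)
            module E = Equivalence (f.preserves s (f.from ∘ ys))
        in mk⇔ (λ r → E.from (N.Rel-resp s (λ i → N.sym (to∘from i)) r))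
               (λ r → N.Rel-resp s to∘from (E.to r))
    }
    where
    module f = _≅_ f
    module N where
      open Structure N public
      open Setoid setoid public using (sym)

  ≅-trans : ∀ {M N O} → M ≅ N → N ≅ O → M ≅ O
  ≅-trans f g = record
    { bij       = Composition.inverse f.bij g.bij
    ; preserves = λ s xs →
        Composition.equivalence (f.preserves s xs) (g.preserves s (f.to ∘ xs))
    }
    where
    module f = _≅_ f
    module g = _≅_ g

  -- The product is composition: (f ∙ g)(x) = f(g(x)).
  Aut : Structure → Group 0ℓ 0ℓ
  Aut M = record
    { Carrier = M ≅ M
    ; _≈_     = λ f g → ∀ x → to f x ≈ to g x
    ; _∙_     = λ f g → ≅-trans g f
    ; ε       = ≅-refl
    ; _⁻¹     = ≅-sym
    ; isGroup = record
      { isMonoid = record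
        { isSemigroup = record
          { isMagma = record
            { isEquivalence = record
              { refl  = λ _ → refl
              ; sym   = λ f≈g x → sym (f≈g x)
              ; trans = λ f≈g g≈h x → trans (f≈g x) (g≈h x)
              }
            ; ∙-cong = λ {f} {f′} {g} {g′} f≈f′ g≈g′ x →
                trans (to-cong f (g≈g′ x)) (f≈f′ (to g′ x))
            }
          ; assoc = λ _ _ _ _ → refl
          }
        ; identity = (λ _ _ → refl) , (λ _ _ → refl)
        }
      ; inverse = (λ f → Inverse.strictlyInverseʳ (bij f))
                , (λ f → Inverse.strictlyInverseˡ (bij f))
      ; ⁻¹-cong = λ {f} {g} f≈g x →
          trans (sym (Inverse.strictlyInverseʳ (bij g) (from f x)))
                (from-cong g (trans (sym (f≈g (from f x)))
                                    (Inverse.strictlyInverseˡ (bij f) x)))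
      }
    }
    where
    open Structure M using (setoid)
    open Setoid setoid
    open _≅_

  -- The topology of pointwise convergence, with M discrete: the basic
  -- neighbourhoods of g are the sets of automorphisms agreeing with g on
  -- a finite set.
  IsOpen : (M : Structure) → Pred (Group.Carrier (Aut M)) p → Set p
  IsOpen M O =
    ∀ g → O g →
    ∃ λ (F : List Carrier) →
      ∀ h → All (λ x → _≅_.to h x ≈ _≅_.to g x) F → O h
    where open Structure M

  IsDense : (M : Structure) → Pred (Group.Carrier (Aut M)) p → Set (lsuc p)
  IsDense {p} M H =
    ∀ (O : Pred (Group.Carrier (Aut M)) p) →
    IsOpen M O → Satisfiable O → Satisfiable (H ∩ O)

  -- C and D below are substructures of one ambient structure U, given by
  -- their underlying subsets.
  module _ {U : Structure} where
    open Structure U using (Carrier; _≈_)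

    infix 4 _Extends_

    _Extends_ : ∀ {A B A′ B′ : Subset U} →
              (U ↾ A′) ≅ (U ↾ B′) → (U ↾ A) ≅ (U ↾ B) → Set
    _Extends_ {A} {B} {A′} g f =
      Σ (A ⊆ A′) λ A⊆A′ →
        ∀ x (x∈A : x ∈ A) →
        value (_≅_.to g (elem x (A⊆A′ x∈A))) ≈ value (_≅_.to f (elem x x∈A))

    record PartialIso (C : Subset U) : Set₁ where
      field
        dom ran    : Subset U
        dom⊆       : dom ⊆ C
        ran⊆       : ran ⊆ C
        dom-finite : IsFiniteStructure (U ↾ dom)
        ran-finite : IsFiniteStructure (U ↾ ran)
        iso        : (U ↾ dom) ≅ (U ↾ ran)

    NonIdentity : ∀ {C} → PartialIso C → Set
    NonIdentity p = ¬ (∀ x → value (_≅_.to iso x) ≈ value x)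
      where open PartialIso p

    -- 𝒫 C is a set of partial maps, so its equality _≈𝒫_ compares
    -- domains and values only.
    record 𝒫 (C : Subset U) : Set₁ where
      field
        partialIso  : PartialIso C
        nonIdentity : NonIdentity partialIso
      open PartialIso partialIso public

    infix 4 _≈𝒫_

    _≈𝒫_ : ∀ {C} → 𝒫 C → 𝒫 C → Set
    p ≈𝒫 q = (𝒫.iso p Extends 𝒫.iso q) × (𝒫.iso q Extends 𝒫.iso p)

    𝒫-inverse : ∀ {C} → 𝒫 C → 𝒫 C
    𝒫-inverse p = record
      { partialIso = record
        { dom = ran ; ran = dom
        ; dom⊆ = ran⊆ ; ran⊆ = dom⊆
        ; dom-finite = ran-finite ; ran-finite = dom-finite
        ; iso = ≅-sym iso
        }
      ; nonIdentity = λ iso⁻¹-id → nonIdentity λ x →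
          sym (trans (sym (Inverse.strictlyInverseʳ (_≅_.bij iso) x))
                     (iso⁻¹-id (_≅_.to iso x)))
      }
      where
      open 𝒫 p
      open Setoid (Structure.setoid U) using (sym; trans)

    𝒫-mono : ∀ {C₁ C₂} → C₁ ⊆ C₂ → 𝒫 C₁ → 𝒫 C₂
    𝒫-mono C₁⊆C₂ p = record
      { partialIso = record
        { dom = dom ; ran = ran
        ; dom⊆ = λ x∈ → C₁⊆C₂ (dom⊆ x∈) ; ran⊆ = λ x∈ → C₁⊆C₂ (ran⊆ x∈)
        ; dom-finite = dom-finite ; ran-finite = ran-finite
        ; iso = iso
        }
      ; nonIdentity = nonIdentity
      }
      where open 𝒫 p

    record HLExtension (C D : Subset U) : Set₁ where
      private
        module AutD = Group (Aut (U ↾ D))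
      field
        C⊆D       : C ⊆ D
        φ         : 𝒫 C → AutD.Carrier
        φ-cong    : ∀ {p q} → p ≈𝒫 q → φ p AutD.≈ φ q
        φ-extends : ∀ p → φ p Extends 𝒫.iso p
        φ-inverse : ∀ p → φ (𝒫-inverse p) AutD.≈ (φ p) AutD.⁻¹

      K : Group (lsuc 0ℓ) 0ℓ
      K = Subgroup.group (⟨_⟩ (Aut (U ↾ D)) λ g → ∃ λ p → g AutD.≈ φ p)

      φᴷ : 𝒫 C → Group.Carrier K
      φᴷ p = φ p , gen (p , AutD.refl {φ p})

    IsMinimal : ∀ {C D} → HLExtension C D → Set₁
    IsMinimal {C} {D} E =
      ∀ b (b∈D : b ∈ D) → ¬ (b ∈ C) →
      ∃ λ (ps : List (𝒫 C)) → ∃ λ a → Σ (a ∈ C) λ a∈C →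
        b ≈ value (_≅_.to (foldr _∙_ ε (map φ ps)) (elem a (C⊆D a∈C)))
      where
      open HLExtension E
      open Group (Aut (U ↾ D)) using (_∙_; ε)

    record Coherent {C₁ C₂ D₁ D₂ : Subset U} (C₁⊆C₂ : C₁ ⊆ C₂)
                    (E₁ : HLExtension C₁ D₁) (E₂ : HLExtension C₂ D₂) : Set₁ where
      private
        module E₁ = HLExtension E₁
        module E₂ = HLExtension E₂
        module K₁ = Group E₁.K
        module K₂ = Group E₂.K
      field
        D₁⊆D₂     : D₁ ⊆ D₂
        φ-extends : ∀ p → E₂.φ (𝒫-mono C₁⊆C₂ p) Extends E₁.φ p
        φ-hom     :
          ∃! (λ (h h′ : K₁.Carrier → K₂.Carrier) → ∀ g → h g K₂.≈ h′ g)
             (λ h → IsGroupMonomorphism K₁.rawGroup K₂.rawGroup h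
                  × (∀ p → h (E₁.φᴷ p) K₂.≈ E₂.φᴷ (𝒫-mono C₁⊆C₂ p)))

  record Ultraextensive (U : Structure) : Set₁ where
    field
      ultrahomogeneous : HLExtension (full U) (full U)
      finite-extension :
        ∀ (C : Subset U) → IsFiniteStructure (U ↾ C) →
        ∃ λ (D : Subset U) → IsFiniteStructure (U ↾ D) × HLExtension C D
      coherent-extension :
        ∀ (C₁ C₂ D₁ : Subset U) →
        IsFiniteStructure (U ↾ C₁) → IsFiniteStructure (U ↾ C₂) →
        (C₁⊆C₂ : C₁ ⊆ C₂) →
        IsFiniteStructure (U ↾ D₁) →
        (E₁ : HLExtension C₁ D₁) → IsMinimal E₁ →
        ∃ λ (D₂ : Subset U) → IsFiniteStructure (U ↾ D₂) ×
        ∃ λ (E₂ : HLExtension C₂ D₂) → IsMinimal E₂ × Coherent C₁⊆C₂ E₁ E₂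

{-# OPTIONS --safe #-}

-- Start from C₀ = D₀ = ∅ and let C (n+1) consist of D n and the n-th batch of
-- an enumeration of U; coherence extends the HL-extension D n of C n to one
-- D (n+1) of C (n+1), with a homomorphism K n → K (n+1) such that the image of
-- each k ∈ K n extends k.  So every k ∈ K n has a limit in Aut(U), and these
-- limits form the union H of an increasing chain of subgroups H n.  A finite part
-- of an automorphism of U is either an identity or a partial isomorphism
-- p ∈ 𝒫 (C n) for some n, and φ n p has a limit in H; hence H is dense.  Elements of H n are determined by
-- their restrictions to the finite set D n, so finitely many elements of H
-- generate a group embedded in a finite set.  Constructively that group must
-- still be enumerated: by the pigeonhole principle, boundedly long words in the
-- generators suffice.

module Submission where

open import Defs
open import Level using (Level; 0ℓ) renaming (suc to lsuc)
open import Algebra.Bundles using (Group; Monoid)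
open import Algebra.Morphism.Structures using (IsGroupHomomorphism; IsGroupMonomorphism)
import Algebra.Properties.Group as GroupProperties
open import Data.Bool.Base using (Bool; true; false; not)
open import Data.Empty using (⊥; ⊥-elim)
open import Data.Fin.Base using (Fin; zero; suc; toℕ; combine; funToFin; finToFun)
open import Data.Fin.Properties using (pigeonhole; finToFun-funToFin; toℕ<n)
import Data.Fin.Properties as Fin
open import Data.List.Base
  using (List; []; _∷_; [_]; _++_; map; foldr; length; lookup; take; drop; tabulate;
         deduplicate; allFin; cartesianProduct; cartesianProductWith)
open import Data.List.Membership.Propositional using () renaming (_∈_ to _∈≡_)
open import Data.List.Membership.Propositional.Properties
  using (∈-allFin; ∈-cartesianProduct⁺) renaming (∈-lookup to ∈≡-lookup)
import Data.List.Membership.Setoid as ListMembership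
open import Data.List.Membership.Setoid.Properties
  using (∈-resp-≈; ∈-lookup; ∈-map⁺; ∈-map⁻; ∈-++⁺ˡ; ∈-++⁺ʳ; ∈-tabulate⁺;
         ∈-cartesianProductWith⁺; ∈-deduplicate⁺)
open import Data.List.Properties using (length-++; length-take; length-drop; take++drop≡id)
open import Data.List.Relation.Unary.All as All
  using (All; []; _∷_; lookupₛ; tabulateₛ; reduce; all?)
open import Data.List.Relation.Unary.All.Properties using (tabulate⁻)
open import Data.List.Relation.Unary.AllPairs using (_∷_)
open import Data.List.Relation.Unary.Any using (here; there; index)
open import Data.List.Relation.Unary.Any.Properties using (lookup-index)
open import Data.List.Relation.Unary.Enumerates.Setoid using (IsEnumeration)
open import Data.List.Relation.Unary.Unique.DecSetoid.Properties using (deduplicate-!)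
import Data.List.Relation.Unary.Unique.Setoid as Uniqueness
open import Data.Nat.Base
  using (ℕ; zero; suc; _+_; _∸_; _⊓_; _⊔_; _≤_; _<_; _≤′_; ≤′-reflexive; ≤′-step; s≤s; s≤s⁻¹)
open import Data.Nat.Induction using (<-wellFounded)
import Data.Nat.Properties as ℕ
open import Data.Nat.Properties
  using (module ≤-Reasoning; _≤?_; +-monoˡ-<; +-suc; m⊓n≤m; m≤m⊔n; m≤n⊔m; m≤m+n;
         m+[n∸m]≡n; ≤-<-trans; ≰⇒>; <⇒≤; ≤⇒≤′)
open import Data.Product.Base using (∃; _×_; _,_; proj₁; proj₂)
open import Data.Sum.Base using (inj₁; inj₂)
open import Function.Base using (_∘_; id)
open import Function.Bundles using (Inverse; Injection; _⇔_; mk⇔; Equivalence)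
open import Function.Properties.Inverse using (Inverse⇒Injection)
open import Induction.WellFounded using (Acc; acc)
open import Relation.Binary.Bundles using (Setoid; DecSetoid)
open import Relation.Binary.Definitions using (Decidable)
open import Relation.Binary.PropositionalEquality as ≡ using (_≡_; subst)
open import Relation.Nullary.Decidable using (yes; no; via-injection)
open import Relation.Nullary.Negation using (contradiction)

private
  variable
    a p c ℓ : Level

-- Finite and finitely generated groups

module _ (S : Setoid c ℓ) where
  open Setoid S
  open Uniqueness S using (Unique)

  lookup-injective : ∀ {xs} → Unique xs → ∀ i j → lookup xs i ≈ lookup xs j → i ≡ j
  lookup-injective (_ ∷ _) zero zero _ = ≡.refl
  lookup-injective {_ ∷ xs} (x∉xs ∷ _) zero (suc j) x≈xⱼ =
    contradiction x≈xⱼ (All.lookup x∉xs (∈≡-lookup j))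
  lookup-injective {_ ∷ xs} (x∉xs ∷ _) (suc i) zero xᵢ≈x =
    contradiction (sym xᵢ≈x) (All.lookup x∉xs (∈≡-lookup i))
  lookup-injective (_ ∷ xs!) (suc i) (suc j) xᵢ≈xⱼ =
    ≡.cong suc (lookup-injective xs! i j xᵢ≈xⱼ)

-- Decidable equality lets repetitions be struck out of `xs`; every element then has exactly one
-- position in what remains.
enumerated⇒finite : (S : DecSetoid c ℓ) (xs : List (DecSetoid.Carrier S)) →
  IsEnumeration (DecSetoid.setoid S) xs → IsFinite (DecSetoid.setoid S)
enumerated⇒finite S xs x∈xs = length ys , record
  { to        = position
  ; from      = lookup ys
  ; to-cong   = λ {x} {y} x≈y →
      position-unique x (position y) (trans x≈y (lookup-index (x∈ys y)))
  ; from-cong = λ { ≡.refl → refl }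
  ; inverse   = (λ {i} {x} → position-unique x i)
              , λ { {x} ≡.refl → sym (lookup-index (x∈ys x)) }
  }
  where
  open DecSetoid S
  open ListMembership setoid using () renaming (_∈_ to _∈ₗ_)
  ys = deduplicate _≟_ xs
  x∈ys : ∀ x → x ∈ₗ ys
  x∈ys x = ∈-deduplicate⁺ setoid _≟_ (λ z≈y x≈y → trans x≈y (sym z≈y)) (x∈xs x)
  position : ∀ x → Fin (length ys)
  position x = index (x∈ys x)
  position-unique : ∀ x i → x ≈ lookup ys i → position x ≡ i
  position-unique x i x≈ = lookup-injective setoid (deduplicate-! S xs) _ i
    (trans (sym (lookup-index (x∈ys x))) x≈)

module Words (M : Monoid c ℓ) {I : Set} (letter : I → Monoid.Carrier M) where
  open Monoid M
  open ListMembership setoid using () renaming (_∈_ to _∈ₗ_)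

  eval : List I → Carrier
  eval = foldr (λ i x → letter i ∙ x) ε

  eval-++ : ∀ v w → eval (v ++ w) ≈ eval v ∙ eval w
  eval-++ []      w = sym (identityˡ _)
  eval-++ (i ∷ v) w = trans (∙-congˡ (eval-++ v w)) (sym (assoc _ _ _))

  module _ (letters : List I) (complete : ∀ i → i ∈≡ letters) where

    ball : ℕ → List Carrier
    ball zero    = [ ε ]
    ball (suc n) = ε ∷ cartesianProductWith (λ i x → letter i ∙ x) letters (ball n)

    eval-∈-ball : ∀ w {n} → length w ≤ n → eval w ∈ₗ ball n
    eval-∈-ball []      {zero}  _         = here refl
    eval-∈-ball []      {suc n} _         = here refl
    eval-∈-ball (i ∷ w) {suc n} (s≤s ∣w∣≤n) = there
      (∈-cartesianProductWith⁺ (≡.setoid I) setoid setoid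
        (λ { ≡.refl x≈y → ∙-congˡ x≈y }) (complete i) (eval-∈-ball w ∣w∣≤n))

    module _ {m} (code : Injection setoid (≡.setoid (Fin m)))
             (generated : ∀ x → ∃ λ w → eval w ≈ x) where

      -- Two suffixes of a word of length ≥ m have the same value, so the
      -- segment between them can be cut out.
      shorten : ∀ w → m ≤ length w → ∃ λ v → length v < length w × eval v ≈ eval w
      shorten w m≤∣w∣
        -- `w` has `suc (length w)` suffixes, the empty one included, so `m ≤ length w` already
        -- forces two of them to share a code.
        with i , j , i<j , code≡ ←
          pigeonhole (s≤s m≤∣w∣) (λ i → Injection.to code (eval (drop (toℕ i) w)))
        = take (toℕ i) w ++ drop (toℕ j) w , shorter , same-value
        where
        shorter : length (take (toℕ i) w ++ drop (toℕ j) w) < length w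
        shorter = begin-strict
          length (take (toℕ i) w ++ drop (toℕ j) w)
            ≡⟨ length-++ (take (toℕ i) w) ⟩
          length (take (toℕ i) w) + length (drop (toℕ j) w)
            ≡⟨ ≡.cong₂ _+_ (length-take (toℕ i) w) (length-drop (toℕ j) w) ⟩
          (toℕ i ⊓ length w) + (length w ∸ toℕ j)
            <⟨ +-monoˡ-< _ (≤-<-trans (m⊓n≤m (toℕ i) (length w)) i<j) ⟩
          toℕ j + (length w ∸ toℕ j)
            ≡⟨ m+[n∸m]≡n (s≤s⁻¹ (toℕ<n j)) ⟩
          length w ∎
          where open ≤-Reasoning
        same-value : eval (take (toℕ i) w ++ drop (toℕ j) w) ≈ eval w
        same-value = begin
          eval (take (toℕ i) w ++ drop (toℕ j) w)
            ≈⟨ eval-++ (take (toℕ i) w) _ ⟩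
          eval (take (toℕ i) w) ∙ eval (drop (toℕ j) w)
            ≈⟨ ∙-congˡ (Injection.injective code code≡) ⟨
          eval (take (toℕ i) w) ∙ eval (drop (toℕ i) w)
            ≈⟨ eval-++ (take (toℕ i) w) _ ⟨
          eval (take (toℕ i) w ++ drop (toℕ i) w)
            ≡⟨ ≡.cong eval (take++drop≡id (toℕ i) w) ⟩
          eval w ∎
          where open import Relation.Binary.Reasoning.Setoid setoid

      short-word : ∀ w → Acc _<_ (length w) → ∃ λ v → length v ≤ m × eval v ≈ eval w
      short-word w (acc rec) with m ≤? length w
      ... | no  m≰∣w∣ = w , <⇒≤ (≰⇒> m≰∣w∣) , refl
      ... | yes m≤∣w∣ =
        let v , ∣v∣<∣w∣ , v≈w = shorten w m≤∣w∣
            u , ∣u∣≤m , u≈v = short-word v (rec ∣v∣<∣w∣)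
        in u , ∣u∣≤m , trans u≈v v≈w

      -- `code` yields decidable equality and the bound `m`, but not which codes are attained; the
      -- elements are therefore listed as values of words of length at most `m`.
      generated⇒finite : IsFinite setoid
      generated⇒finite = enumerated⇒finite decSetoid (ball m) λ x →
        let w , w≈x = generated x
            v , ∣v∣≤m , v≈w = short-word w (<-wellFounded _)
        in ∈-resp-≈ setoid (trans v≈w w≈x) (eval-∈-ball v ∣v∣≤m)
        where
        decSetoid : DecSetoid _ _
        decSetoid = record
          { isDecEquivalence = record
            { isEquivalence = isEquivalence
            ; _≟_           = via-injection code Fin._≟_
            } }

module _ (G : Group c ℓ) (xs : List (Group.Carrier G)) where
  open Group G
  open ListMembership setoid using () renaming (_∈_ to _∈ₗ_)
  open GroupProperties G
  open import Relation.Binary.Reasoning.Setoid setoid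
  private
    ⟨xs⟩ = Subgroup.group (⟨ G ⟩ (λ x → x ∈ₗ xs))
    module ⟨xs⟩ = Group ⟨xs⟩
    -- `Words` works in a monoid, so the inverses of the generators enter as letters of their own,
    -- marked `false`.
    Letter = Bool × Fin (length xs)

    letter : Letter → ⟨xs⟩.Carrier
    letter (true  , i) = lookup xs i , gen (∈-lookup setoid xs i)
    letter (false , i) = letter (true , i) ⟨xs⟩.⁻¹

    open Words ⟨xs⟩.monoid letter

    evalᴳ : List Letter → Carrier
    evalᴳ w = proj₁ (eval w)

    flip-letter : Letter → Letter
    flip-letter (b , i) = not b , i

    letter-flip : ∀ l → proj₁ (letter (flip-letter l)) ≈ proj₁ (letter l) ⁻¹
    letter-flip (true  , i) = refl
    letter-flip (false , i) = sym (⁻¹-involutive _)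

    inverse-word : ∀ w → ∃ λ v → evalᴳ v ≈ evalᴳ w ⁻¹
    inverse-word []      = [] , sym ε⁻¹≈ε
    inverse-word (l ∷ w) with v , v≈w⁻¹ ← inverse-word w
      = v ++ [ flip-letter l ] , (begin
      evalᴳ (v ++ [ flip-letter l ])                  ≈⟨ eval-++ v _ ⟩
      evalᴳ v ∙ (proj₁ (letter (flip-letter l)) ∙ ε)  ≈⟨ ∙-cong v≈w⁻¹ (identityʳ _) ⟩
      evalᴳ w ⁻¹ ∙ proj₁ (letter (flip-letter l))     ≈⟨ ∙-congˡ (letter-flip l) ⟩
      evalᴳ w ⁻¹ ∙ proj₁ (letter l) ⁻¹                ≈⟨ ⁻¹-anti-homo-∙ _ _ ⟨
      (proj₁ (letter l) ∙ evalᴳ w) ⁻¹                 ∎)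

    word : ∀ {x} → Generated G (λ y → y ∈ₗ xs) x → ∃ λ w → evalᴳ w ≈ x
    word (gen x∈xs) = [ true , index x∈xs ] , trans (identityʳ _) (sym (lookup-index x∈xs))
    word unit = [] , refl
    word (mul x∈ y∈) with v , v≈x ← word x∈ | w , w≈y ← word y∈ =
      v ++ w , trans (eval-++ v w) (∙-cong v≈x w≈y)
    word (inv x∈) with v , v≈x ← word x∈ with w , w≈v⁻¹ ← inverse-word v =
      w , trans w≈v⁻¹ (⁻¹-cong v≈x)
    word (eq x≈y x∈) with w , w≈x ← word x∈ = w , trans w≈x x≈y

  finitely-generated⇒finite : ∀ {m} → Injection ⟨xs⟩.setoid (≡.setoid (Fin m)) →
    IsFinite ⟨xs⟩.setoid
  finitely-generated⇒finite code =
    generated⇒finite letters complete code λ (x , x∈) → word x∈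
    where
    signs : List Bool
    signs = true ∷ false ∷ []
    sign-∈ : ∀ b → b ∈≡ signs
    sign-∈ true  = here ≡.refl
    sign-∈ false = there (here ≡.refl)
    letters : List Letter
    letters = cartesianProduct signs (allFin _)
    complete : ∀ l → l ∈≡ letters
    complete (b , i) = ∈-cartesianProduct⁺ (sign-∈ b) (∈-allFin i)

-- Direct limits of groups of partial automorphisms

module _ (P : ℕ → Set p) (step : ∀ n → P n → P (suc n)) where

  step⇒mono′ : ∀ {m n} → m ≤′ n → P m → P n
  step⇒mono′ (≤′-reflexive ≡.refl) = id
  step⇒mono′ (≤′-step m≤n)         = step _ ∘ step⇒mono′ m≤n

  step⇒mono : ∀ {m n} → m ≤ n → P m → P n
  step⇒mono = step⇒mono′ ∘ ≤⇒≤′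

-- The maximum of the individual indices serves all entries. This brings finitely many points of
-- `U`, or finitely many elements of the limit group, to a single stage.
common-index : {A : Set a} (P : ℕ → A → Set p) → (∀ n x → P n x → P (suc n) x) →
  ∀ {xs} → All (λ x → ∃ λ n → P n x) xs → ∃ λ n → All (P n) xs
common-index P step [] = 0 , []
common-index P step ((m , Px) ∷ Pxs) with n , Pxs ← common-index P step Pxs =
  m ⊔ n , mono (m≤m⊔n m n) Px ∷ All.map (mono (m≤n⊔m m n)) Pxs
  where
  mono : ∀ {m n x} → m ≤ n → P m x → P n x
  mono {x = x} = step⇒mono (λ n → P n x) (λ n → step n x)

funToFin-cong : ∀ {m n} {f g : Fin m → Fin n} → (∀ i → f i ≡ g i) → funToFin f ≡ funToFin g
funToFin-cong {zero}  f≗g = ≡.refl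
funToFin-cong {suc m} f≗g = ≡.cong₂ combine (f≗g zero) (funToFin-cong (f≗g ∘ suc))

-- An automorphism is read as a table of values on `Fin n`, and `funToFin` packs the table into a
-- single number.
Aut-injection : ∀ {L} (M : Structure {L}) → IsFiniteStructure M →
  ∃ λ m → Injection (Group.setoid (Aut M)) (≡.setoid (Fin m))
Aut-injection M (n , M↔n) = _ , record
  { to        = funToFin ∘ table
  ; cong      = λ f≈g → funToFin-cong λ i → to-cong (f≈g (from i))
  ; injective = λ {f} {g} code≡ x → begin
      _≅_.to f x                ≈⟨ _≅_.to-cong f (strictlyInverseʳ x) ⟨
      _≅_.to f (from (to x))    ≈⟨ strictlyInverseʳ _ ⟨
      from (table f (to x))     ≈⟨ from-cong (table-injective f g code≡ (to x)) ⟩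
      from (table g (to x))     ≈⟨ strictlyInverseʳ _ ⟩
      _≅_.to g (from (to x))    ≈⟨ _≅_.to-cong g (strictlyInverseʳ x) ⟩
      _≅_.to g x                ∎
  }
  where
  open Inverse M↔n
  open import Relation.Binary.Reasoning.Setoid (Structure.setoid M)
  table : M ≅ M → Fin n → Fin n
  table f i = to (_≅_.to f (from i))
  table-injective : ∀ f g → funToFin (table f) ≡ funToFin (table g) →
    ∀ i → table f i ≡ table g i
  table-injective f g code≡ i =
    ≡.trans (≡.sym (finToFun-funToFin (table f) i))
      (≡.trans (≡.cong (λ c → finToFun c i) code≡) (finToFun-funToFin (table g) i))

module DirectedLimit {L : Language} (U : Structure {L})
  (D : ℕ → Subset U) (D⊆ : ∀ n → D n ⊆ D (suc n))
  (covers : ∀ x → ∃ λ n → x ∈ D n)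
  (K : ∀ n → Subgroup (Aut (U ↾ D n)) (lsuc 0ℓ))
  (h : ∀ n → Group.Carrier (Subgroup.group (K n)) →
             Group.Carrier (Subgroup.group (K (suc n))))
  (h-homo : ∀ n → IsGroupHomomorphism (Group.rawGroup (Subgroup.group (K n)))
                    (Group.rawGroup (Subgroup.group (K (suc n)))) (h n))
  (h-extends : ∀ n k → proj₁ (h n k) Extends proj₁ k)
  where

  open Structure U
  open Setoid setoid using (refl; sym; trans)
  private
    module K n = Group (Subgroup.group (K n))
    module h n = IsGroupHomomorphism (h-homo n)

  D-mono : ∀ {m n x} → m ≤ n → x ∈ D m → x ∈ D n
  D-mono {x = x} = step⇒mono (λ n → x ∈ D n) (λ n → D⊆ n)

  apply : ∀ n → K.Carrier n → ∀ {x} → x ∈ D n → Carrier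
  apply n k x∈ = Element.value (_≅_.to (proj₁ k) (elem _ x∈))

  apply-∈ : ∀ n k {x} (x∈ : x ∈ D n) → apply n k x∈ ∈ D n
  apply-∈ n k x∈ = Element.member (_≅_.to (proj₁ k) (elem _ x∈))

  -- With `refl` as the last argument, this identifies two applications that differ only in the
  -- proof of membership in `D n`.
  apply-cong : ∀ n k {x y} (x∈ : x ∈ D n) (y∈ : y ∈ D n) → x ≈ y →
    apply n k x∈ ≈ apply n k y∈
  apply-cong n k x∈ y∈ = _≅_.to-cong (proj₁ k)

  h-apply : ∀ n k {x} (x∈ : x ∈ D n) → apply (suc n) (h n k) (D⊆ n x∈) ≈ apply n k x∈
  h-apply n k x∈ with D⊆′ , extends ← h-extends n k =
    trans (apply-cong (suc n) (h n k) _ _ refl) (extends _ x∈)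

  -- The image of k ∈ K n in K (m + n) sends x to y, if it is defined at x.
  ValueAt : ℕ → ∀ n → K.Carrier n → Carrier → Carrier → Set
  ValueAt zero    n k x y = (x∈ : x ∈ D n) → apply n k x∈ ≈ y
  ValueAt (suc m) n k x y = ValueAt m (suc n) (h n k) x y

  -- The limit of `k` as a relation: stages where `x` is missing impose no condition, so no stage
  -- has to be chosen for `x`, and the group laws can be checked for each `m` separately.
  Value : ∀ n → K.Carrier n → Carrier → Carrier → Set
  Value n k x y = ∀ m → ValueAt m n k x y

  ValueAt-resp : ∀ m n {k k′ x x′ y y′} → K._≈_ n k k′ → x ≈ x′ → y ≈ y′ →
    ValueAt m n k x y → ValueAt m n k′ x′ y′
  ValueAt-resp zero n {k} {k′} k≈k′ x≈x′ y≈y′ v x′∈ =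
    trans (apply-cong n k′ x′∈ x∈ (sym x≈x′))
      (trans (sym (k≈k′ (elem _ x∈))) (trans (v x∈) y≈y′))
    where x∈ = Subset.resp (D n) (sym x≈x′) x′∈
  ValueAt-resp (suc m) n {k} {k′} k≈k′ =
    ValueAt-resp m (suc n) {h n k} {h n k′} (h.⟦⟧-cong n {k} {k′} k≈k′)

  -- A value persists once it is defined, because `h n k` extends `k` at every stage.
  apply-value : ∀ n k {x} (x∈ : x ∈ D n) → Value n k x (apply n k x∈)
  apply-value n k x∈ zero    = λ _ → apply-cong n k _ _ refl
  apply-value n k x∈ (suc m) =
    ValueAt-resp m (suc n) {h n k} (K.refl (suc n) {h n k}) refl (h-apply n k x∈)
      (apply-value (suc n) (h n k) (D⊆ n x∈) m)

  value-∙ : ∀ m n k k′ {x y z} → ValueAt m n k′ x y → ValueAt m n k y z →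
    ValueAt m n (K._∙_ n k k′) x z
  value-∙ zero n k k′ v′ v x∈ =
    trans (apply-cong n k (apply-∈ n k′ x∈) y∈ (v′ x∈)) (v y∈)
    -- `k′` maps `D n` to itself, so `y` lies in `D n` and the hypothesis on `k` applies to it.
    where y∈ = Subset.resp (D n) (v′ x∈) (apply-∈ n k′ x∈)
  value-∙ (suc m) n k k′ v′ v =
    ValueAt-resp m (suc n)
      (K.sym (suc n) {h n (K._∙_ n k k′)} {K._∙_ (suc n) (h n k) (h n k′)} (h.homo n k k′))
      refl refl (value-∙ m (suc n) (h n k) (h n k′) v′ v)

  value-ε : ∀ m n {x} → ValueAt m n (K.ε n) x x
  value-ε zero    n = λ _ → refl
  value-ε (suc m) n = ValueAt-resp m (suc n)
    (K.sym (suc n) {h n (K.ε n)} {K.ε (suc n)} (h.ε-homo n))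
    refl refl (value-ε m (suc n))

  -- The inductions on `d` keep the stage where `x` is present and move the base stage from `n` to
  -- `suc n`; the two sums agree only up to `+-suc`.
  ∈-suc : ∀ d n {x} → x ∈ D (suc d + n) → x ∈ D (d + suc n)
  ∈-suc d n {x} = subst (λ j → x ∈ D j) (≡.sym (+-suc d n))

  value-unique-at : ∀ d n {k k′ x y y′} → K._≈_ n k k′ → x ∈ D (d + n) →
    Value n k x y → Value n k′ x y′ → y ≈ y′
  value-unique-at zero n k≈k′ x∈ v v′ =
    trans (sym (v 0 x∈)) (trans (k≈k′ (elem _ x∈)) (v′ 0 x∈))
  value-unique-at (suc d) n {k} {k′} k≈k′ x∈ v v′ =
    value-unique-at d (suc n) {h n k} {h n k′} (h.⟦⟧-cong n {k} {k′} k≈k′) (∈-suc d n x∈)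
      (v ∘ suc) (v′ ∘ suc)

  -- `k` and `k′` need only agree on `D n`: an element of `K n` is thereby seen to fix its limit on
  -- all of `U`, and `k k⁻¹` can be compared with `ε`.
  value-unique : ∀ n {k k′ x y y′} → K._≈_ n k k′ → Value n k x y → Value n k′ x y′ → y ≈ y′
  value-unique n {x = x} k≈k′ with d , x∈ ← covers x =
    -- The stage `d` of `x` doubles as the distance from `n`, since `D d ⊆ D (d + n)`.
    value-unique-at d n k≈k′ (D-mono (m≤m+n d n) x∈)

  value-exists-at : ∀ d n k {x} → x ∈ D (d + n) → ∃ λ y → Value n k x y
  value-exists-at zero    n k x∈ = apply n k x∈ , apply-value n k x∈
  value-exists-at (suc d) n k x∈
    with y , v ← value-exists-at d (suc n) (h n k) (∈-suc d n x∈)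
    -- The value `y` is found from stage `suc n` on. If `x` is already present at stage `n`,
    -- `h-apply` shows that stage `n` agrees.
    = y , λ { zero    → λ x∈ → trans (sym (h-apply n k x∈)) (v 0 (D⊆ n x∈))
            ; (suc m) → v m }

  value-exists : ∀ n k x → ∃ λ y → Value n k x y
  value-exists n k x with d , x∈ ← covers x = value-exists-at d n k (D-mono (m≤m+n d n) x∈)

  Represents : ∀ n → K.Carrier n → (Carrier → Carrier) → Set
  Represents n k f = ∀ x → Value n k x (f x)

  common-stage : ∀ {s} (xs : Fin s → Carrier) → ∃ λ n → ∀ i → xs i ∈ D n
  common-stage xs
    with n , xs∈ ← common-index (λ n x → x ∈ D n) (λ n _ → D⊆ n)
                     (All.universal covers (tabulate xs))
    = n , tabulate⁻ xs∈

  -- Once all entries of the tuple are present, `f` agrees on them with an automorphism of the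
  -- structure induced on that stage. Arities are finite, so `common-stage` supplies such a stage.
  represents⇒preserves-at : ∀ d n k {f} → Represents n k f → ∀ s xs →
    (∀ i → xs i ∈ D (d + n)) → Rel s xs ⇔ Rel s (f ∘ xs)
  represents⇒preserves-at zero n k r s xs xs∈ = mk⇔
    (λ R → Rel-resp s (λ i → r (xs i) 0 (xs∈ i)) (E.to R))
    (λ R → E.from (Rel-resp s (λ i → sym (r (xs i) 0 (xs∈ i))) R))
    where module E = Equivalence (_≅_.preserves (proj₁ k) s (λ i → elem (xs i) (xs∈ i)))
  represents⇒preserves-at (suc d) n k r s xs xs∈ =
    represents⇒preserves-at d (suc n) (h n k) (λ x → r x ∘ suc) s xs
      (λ i → ∈-suc d n (xs∈ i))

  limit : ∀ n → K.Carrier n → U ≅ U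
  limit n k = record
    { bij = record
      { to        = f k
      ; from      = f k⁻¹
      ; to-cong   = f-cong k
      ; from-cong = f-cong k⁻¹
      ; inverse   = (λ {x} y≈ → trans (f-cong k y≈) (cancel k k⁻¹ (K.inverseʳ n k) x))
                  , (λ {x} y≈ → trans (f-cong k⁻¹ y≈) (cancel k⁻¹ k (K.inverseˡ n k) x))
      }
    ; preserves = λ s xs → let d , xs∈ = common-stage xs in
        represents⇒preserves-at d n k (represents k) s xs (D-mono (m≤m+n d n) ∘ xs∈)
    }
    where
    k⁻¹ = K._⁻¹ n k
    f : K.Carrier n → Carrier → Carrier
    f k x = proj₁ (value-exists n k x)
    represents : ∀ k → Represents n k (f k)
    represents k x = proj₂ (value-exists n k x)
    f-cong : ∀ k {x y} → x ≈ y → f k x ≈ f k y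
    f-cong k {x} {y} x≈y = value-unique n {k} {k} (K.refl n {k}) (represents k x)
      (λ m → ValueAt-resp m n {k} (K.refl n {k}) (sym x≈y) refl (represents k y m))
    -- The values of `k k′` and of `ε` at `x` are compared: the former is `f k (f k′ x)`, the latter
    -- `x`. Used in both orders, this makes the limit of `k⁻¹` the inverse.
    cancel : ∀ k k′ → K._≈_ n (K._∙_ n k k′) (K.ε n) → ∀ x → f k (f k′ x) ≈ x
    cancel k k′ kk′≈ε x = value-unique n {K._∙_ n k k′} {K.ε n} kk′≈ε
      (λ m → value-∙ m n k k′ (represents k′ x m) (represents k (f k′ x) m))
      (λ m → value-ε m n)

  limit-represents : ∀ n k → Represents n k (_≅_.to (limit n k))
  limit-represents n k x = proj₂ (value-exists n k x)

  limit-apply : ∀ n k {x} (x∈ : x ∈ D n) → _≅_.to (limit n k) x ≈ apply n k x∈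
  limit-apply n k {x} x∈ = sym (limit-represents n k x 0 x∈)

  -- `k⁻¹` at `y` is controlled by `k` at a different point, `k⁻¹ y`; hence the hypothesis ranges
  -- over all points at the one stage `m`.
  represents-⁻¹ : ∀ m n k (g : U ≅ U) → (∀ x → ValueAt m n k x (_≅_.to g x)) →
    ∀ y → ValueAt m n (K._⁻¹ n k) y (_≅_.from g y)
  represents-⁻¹ zero n k g r y y∈ = begin
    x                         ≈⟨ Inverse.strictlyInverseʳ (_≅_.bij g) x ⟨
    _≅_.from g (_≅_.to g x)   ≈⟨ _≅_.from-cong g (r x (apply-∈ n (K._⁻¹ n k) y∈)) ⟨
    _≅_.from g (apply n k _)  ≈⟨ _≅_.from-cong g (K.inverseʳ n k (elem y y∈)) ⟩
    _≅_.from g y              ∎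
    where
    open import Relation.Binary.Reasoning.Setoid setoid
    x = apply n (K._⁻¹ n k) y∈
  represents-⁻¹ (suc m) n k g r y =
    ValueAt-resp m (suc n)
      (K.sym (suc n) {h n (K._⁻¹ n k)} {K._⁻¹ (suc n) (h n k)} (h.⁻¹-homo n k))
      refl refl (represents-⁻¹ m (suc n) (h n k) g r y)

  -- `g` is tied to `k` through values and not as `limit n k`, so that closure under the group
  -- operations is read off from the rules for `ValueAt`.
  Represented : ℕ → U ≅ U → Set (lsuc 0ℓ)
  Represented n g = ∃ λ k → Represents n k (_≅_.to g)

  represented-suc : ∀ n g → Represented n g → Represented (suc n) g
  represented-suc n g (k , r) = h n k , λ x → r x ∘ suc

  represented-mono : ∀ {m n} g → m ≤ n → Represented m g → Represented n g
  represented-mono g = step⇒mono (λ n → Represented n g) (λ n → represented-suc n g)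

  stage-group : ∀ n → Subgroup (Aut U) (lsuc 0ℓ)
  stage-group n = record
    { pred      = Represented n
    ; resp      = λ { f≈g (k , r) →
        k , λ x m → ValueAt-resp m n {k} (K.refl n {k}) refl (f≈g x) (r x m) }
    ; ε-closed  = K.ε n , λ x m → value-ε m n
    ; ∙-closed  = λ { {f} {g} (k , r) (k′ , r′) →
        K._∙_ n k k′ , λ x m → value-∙ m n k k′ (r′ x m) (r (_≅_.to g x) m) }
    ; ⁻¹-closed = λ { {g} (k , r) →
        K._⁻¹ n k , λ y m → represents-⁻¹ m n k g (λ x → r x m) y }
    }

  module stage-group n = Subgroup (stage-group n)

  limit-group : Subgroup (Aut U) (lsuc 0ℓ)
  limit-group = record
    { pred      = λ g → ∃ λ n → Represented n g
    ; resp      = λ { {f} {g} f≈g (n , r) → n , stage-group.resp n {f} {g} f≈g r }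
    ; ε-closed  = 0 , stage-group.ε-closed 0
    ; ∙-closed  = λ { {f} {g} (m , r) (n , r′) → m ⊔ n ,
        stage-group.∙-closed (m ⊔ n) {f} {g}
          (represented-mono f (m≤m⊔n m n) r) (represented-mono g (m≤n⊔m m n) r′) }
    ; ⁻¹-closed = λ { {g} (n , r) → n , stage-group.⁻¹-closed n {g} r }
    }

  limit-∈ : ∀ n k → Subgroup.pred limit-group (limit n k)
  limit-∈ n k = n , k , limit-represents n k

  -- The generators, and so everything they generate, lie in one stage group; restriction to the
  -- finite set `D N` is the code that `finitely-generated⇒finite` asks for.
  limit-group-locallyFinite : (∀ n → IsFiniteStructure (U ↾ D n)) →
    LocallyFinite (Subgroup.group limit-group)
  limit-group-locallyFinite D-finite xs = finitely-generated⇒finite H xs record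
    { to        = λ (g , g∈) → code.to (restriction g∈)
    -- The element of `K N` found for `g` depends on the derivation `g∈`, but on `D N` it agrees
    -- with `g`, so the code depends on `g` alone.
    ; cong      = λ { {f , f∈} {g , g∈} f≈g →
        code.cong {restriction f∈} {restriction g∈} λ { (elem x x∈) →
        trans (represents f∈ x 0 x∈) (trans (f≈g x) (sym (represents g∈ x 0 x∈))) } }
    ; injective = λ { {f , f∈} {g , g∈} code≡ x →
        value-unique N {proj₁ (represented f∈)} {proj₁ (represented g∈)}
          (code.injective {restriction f∈} {restriction g∈} code≡)
          (represents f∈ x) (represents g∈ x) }
    }
    where
    H = Subgroup.group limit-group
    module H = Group H
    open ListMembership H.setoid using () renaming (_∈_ to _∈ₗ_)
    common = common-index (λ n (x : H.Carrier) → Represented n (proj₁ x))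
      (λ n x → represented-suc n (proj₁ x)) (All.universal proj₂ xs)
    N = proj₁ common
    module code = Injection (proj₂ (Aut-injection (U ↾ D N) (D-finite N)))
    represented : ∀ {g} → Generated H (λ x → x ∈ₗ xs) g → Represented N (proj₁ g)
    represented (gen {g} g∈) =
      lookupₛ H.setoid (λ { {f , _} {g , _} → stage-group.resp N {f} {g} })
        (proj₂ common) {g} g∈
    represented unit = stage-group.ε-closed N
    represented (mul {f , _} {g , _} f∈ g∈) =
      stage-group.∙-closed N {f} {g} (represented f∈) (represented g∈)
    represented (inv {g , _} g∈) = stage-group.⁻¹-closed N {g} (represented g∈)
    represented (eq {f , _} {g , _} f≈g f∈) = stage-group.resp N {f} {g} f≈g (represented f∈)
    restriction : ∀ {g} → Generated H (λ x → x ∈ₗ xs) g → (U ↾ D N) ≅ (U ↾ D N)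
    restriction g∈ = proj₁ (proj₁ (represented g∈))
    represents : ∀ {g} (g∈ : Generated H (λ x → x ∈ₗ xs) g) →
      Represents N (proj₁ (represented g∈)) (_≅_.to (proj₁ g))
    represents g∈ = proj₂ (represented g∈)

-- The tower of HL-extensions

-- Countability provides the decidable equality by which lists of points form finite substructures
-- and by which it is decided whether an automorphism fixes a given list.
countable⇒≟ : (S : Setoid c ℓ) → IsCountable S → Decidable (Setoid._≈_ S)
countable⇒≟ S (inj₁ (_ , S↔Fin)) = via-injection (Inverse⇒Injection S↔Fin) Fin._≟_
countable⇒≟ S (inj₂ S↔ℕ)         = via-injection (Inverse⇒Injection S↔ℕ) ℕ._≟_

module _ (S : Setoid c ℓ) where
  open Setoid S
  open ListMembership S using () renaming (_∈_ to _∈ₗ_)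

  finite⇒listable : IsFinite S → ∃ λ xs → ∀ x → x ∈ₗ xs
  finite⇒listable (_ , S↔Fin) = tabulate from , λ x →
    ∈-resp-≈ S (strictlyInverseʳ x) (∈-tabulate⁺ S (to x))
    where open Inverse S↔Fin

  -- Lists instead of single points treat the finite case, with `S` possibly empty, as a constant
  -- sequence.
  countable⇒exhausted-by-lists : IsCountable S →
    ∃ λ (batch : ℕ → List Carrier) → ∀ x → ∃ λ n → x ∈ₗ batch n
  countable⇒exhausted-by-lists (inj₁ S-finite) with xs , x∈xs ← finite⇒listable S-finite =
    (λ _ → xs) , λ x → 0 , x∈xs x
  countable⇒exhausted-by-lists (inj₂ S↔ℕ) = (λ n → [ from n ]) , λ x →
    to x , here (sym (strictlyInverseʳ x))
    where open Inverse S↔ℕ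

module FiniteSubsets {L : Language} (U : Structure {L}) where
  open Structure U
  open Setoid setoid using (refl; sym; trans)
  open ListMembership setoid using () renaming (_∈_ to _∈ₗ_)
  open Element

  listed : List Carrier → Subset U
  listed xs = record { pred = λ x → x ∈ₗ xs ; resp = ∈-resp-≈ setoid }

  listed-finite : Decidable _≈_ → ∀ xs → IsFiniteStructure (U ↾ listed xs)
  listed-finite _≟_ xs = enumerated⇒finite decSetoid (reduce (elem _) listed-members) λ x →
    ∈-reduce x listed-members (member x)
    where
    decSetoid : DecSetoid 0ℓ 0ℓ
    decSetoid = record
      { isDecEquivalence = record
        { isEquivalence = Setoid.isEquivalence (Structure.setoid (U ↾ listed xs))
        ; _≟_           = λ x y → value x ≟ value y
        } }
    open ListMembership (Structure.setoid (U ↾ listed xs)) using () renaming (_∈_ to _∈ₑ_)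
    listed-members : All (_∈ listed xs) xs
    listed-members = tabulateₛ setoid id
    ∈-reduce : ∀ (x : Element (listed xs)) {ys} (ys⊆xs : All (_∈ listed xs) ys) →
      value x ∈ₗ ys → x ∈ₑ reduce (elem _) ys⊆xs
    ∈-reduce x (_ ∷ _)     (here x≈y)   = here x≈y
    ∈-reduce x (_ ∷ ys⊆xs) (there x∈ys) = there (∈-reduce x ys⊆xs x∈ys)

  -- Serves to make `D n` part of the next `C`, with concatenation of lists in the role of union.
  finite⇒⊆listed : (D : Subset U) → IsFiniteStructure (U ↾ D) → ∃ λ xs → D ⊆ listed xs
  finite⇒⊆listed D D-finite
    with es , e∈es ← finite⇒listable (Structure.setoid (U ↾ D)) D-finite
    = map value es , λ {x} x∈D → let e = elem x x∈D in
        ∈-map⁺ (Structure.setoid (U ↾ D)) setoid id {v = e} (e∈es e)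

  restrict : (g : U ≅ U) (xs : List Carrier) →
    (U ↾ listed xs) ≅ (U ↾ listed (map (_≅_.to g) xs))
  restrict g xs = record
    { bij = record
      { to        = λ (elem x x∈) → elem (g.to x) (∈-map⁺ setoid setoid g.to-cong x∈)
      ; from      = λ (elem y y∈) → elem (g.from y) (from-∈ y∈)
      ; to-cong   = g.to-cong
      ; from-cong = g.from-cong
      ; inverse   = Inverse.inverseˡ g.bij , Inverse.inverseʳ g.bij
      }
    ; preserves = λ s es → g.preserves s (value ∘ es)
    }
    where
    module g = _≅_ g
    from-∈ : ∀ {y} → y ∈ₗ map g.to xs → g.from y ∈ₗ xs
    from-∈ y∈ with x , x∈ , y≈gx ← ∈-map⁻ setoid setoid y∈ =
      ∈-resp-≈ setoid (sym (Inverse.inverseʳ g.bij y≈gx)) x∈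

  -- A basic neighbourhood of `g` tests finitely many points only, so it contains every automorphism
  -- that extends the restriction of `g` to them.
  extends-partialIsos⇒dense : Decidable _≈_ →
    (C : ℕ → Subset U) → (∀ n → C n ⊆ C (suc n)) → (∀ x → ∃ λ n → x ∈ C n) →
    (H : Subgroup (Aut U) p) →
    (∀ n (q : 𝒫 (C n)) → ∃ λ g → Subgroup.pred H g ×
      (∀ x (x∈ : x ∈ 𝒫.dom q) → _≅_.to g x ≈ value (_≅_.to (𝒫.iso q) (elem x x∈)))) →
    IsDense U (Subgroup.pred H)
  extends-partialIsos⇒dense _≟_ C C-suc C-covers H extend O O-open (g , g∈O)
    with xs , nearby ← O-open g g∈O
    -- `𝒫` excludes restrictions of the identity, so that case is separated and met by the identity
    -- of `H`.
    with all? (λ x → _≅_.to g x ≟ x) xs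
  ... | yes g≈id = ≅-refl , Subgroup.ε-closed H , nearby ≅-refl (All.map sym g≈id)
  ... | no  g≉id =
    let g′ , g′∈ , g′-extends = extend N g↾xs
    in g′ , g′∈ , nearby g′ (tabulateₛ setoid (λ x∈ → g′-extends _ x∈))
    where
    ys = map (_≅_.to g) xs
    -- The range must lie in `C N` as well as the domain, hence a stage common to `xs` and `ys`.
    common = common-index (λ n x → x ∈ C n) (λ n _ → C-suc n)
      (All.universal C-covers (xs ++ ys))
    N = proj₁ common
    listed⊆C : listed (xs ++ ys) ⊆ C N
    listed⊆C = lookupₛ setoid (Subset.resp (C N)) (proj₂ common)
    g↾xs : 𝒫 (C N)
    g↾xs = record
      { partialIso = record
        { dom = listed xs ; ran = listed ys
        ; dom⊆ = listed⊆C ∘ ∈-++⁺ˡ setoid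
        ; ran⊆ = listed⊆C ∘ ∈-++⁺ʳ setoid xs
        ; dom-finite = listed-finite _≟_ xs
        ; ran-finite = listed-finite _≟_ ys
        ; iso = restrict g xs
        }
      ; nonIdentity = λ g≈id → g≉id (tabulateₛ setoid λ x∈ → g≈id (elem _ x∈))
      }

  ∅ : Subset U
  ∅ = record { pred = λ _ → ⊥ ; resp = λ _ () }

  ∅-finite : IsFiniteStructure (U ↾ ∅)
  ∅-finite = 0 , record
    { to = λ () ; from = λ () ; to-cong = λ { {()} } ; from-cong = λ { {()} }
    ; inverse = (λ { {()} }) , (λ { {()} }) }

  -- A partial isomorphism of `∅` has empty domain and so is an identity; thus `𝒫 ∅` is empty and
  -- any `φ` will do. The tower has to start from a minimal extension, and this one is minimal
  -- vacuously.
  ∅-extension : HLExtension ∅ ∅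
  ∅-extension = record
    { C⊆D       = id
    ; φ         = λ _ → ≅-refl
    ; φ-cong    = λ { _ (elem _ ()) }
    ; φ-extends = λ p → 𝒫.dom⊆ p , λ x x∈ → ⊥-elim (𝒫.dom⊆ p x∈)
    ; φ-inverse = λ { _ (elem _ ()) }
    }

  ∅-minimal : IsMinimal ∅-extension
  ∅-minimal _ ()

module _ {L : Language} {U : Structure {L}} {C₁ C₂ D₁ D₂ : Subset U} {C₁⊆C₂ : C₁ ⊆ C₂}
  {E₁ : HLExtension C₁ D₁} {E₂ : HLExtension C₂ D₂} (coherent : Coherent C₁⊆C₂ E₁ E₂) where
  open Structure U
  open Setoid setoid using (refl; sym; trans)
  private
    module E₁ = HLExtension E₁
    module E₂ = HLExtension E₂
    module K₁ = Group E₁.K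
    module K₂ = Group E₂.K
    module A₁ = Group (Aut (U ↾ D₁))

  open Coherent coherent

  transfer : K₁.Carrier → K₂.Carrier
  transfer = proj₁ φ-hom

  transfer-isGroupMonomorphism : IsGroupMonomorphism K₁.rawGroup K₂.rawGroup transfer
  transfer-isGroupMonomorphism = proj₁ (proj₁ (proj₂ φ-hom))

  transfer-φ : ∀ p → transfer (E₁.φᴷ p) K₂.≈ E₂.φᴷ (𝒫-mono C₁⊆C₂ p)
  transfer-φ = proj₂ (proj₁ (proj₂ φ-hom))

  private module h = IsGroupMonomorphism transfer-isGroupMonomorphism

  -- Coherence gives the extension property for the generators `φ p` only. As `transfer` is a
  -- homomorphism, induction on the derivation of `k` carries it to the whole generated group.
  transfer-extends : ∀ k → proj₁ (transfer k) Extends proj₁ k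
  transfer-extends (k , k∈K) = D₁⊆D₂ , λ x x∈ → agree k∈K (elem x x∈)
    where
    embed : Element D₁ → Element D₂
    embed (elem x x∈) = elem x (D₁⊆D₂ x∈)

    agree : ∀ {k} (k∈K : Generated (Aut (U ↾ D₁)) (λ g → ∃ λ p → g A₁.≈ E₁.φ p) k) e →
      Element.value (_≅_.to (proj₁ (transfer (k , k∈K))) (embed e))
        ≈ Element.value (_≅_.to k e)
    agree {k} k∈K@(gen (p , k≈φp)) e@(elem x x∈) =
      trans (h.⟦⟧-cong {k , k∈K} {E₁.φᴷ p} k≈φp (embed e))
        (trans (transfer-φ p (embed e))
          (trans (_≅_.to-cong (E₂.φ (𝒫-mono C₁⊆C₂ p)) refl)
            (trans (proj₂ (φ-extends p) x x∈) (sym (k≈φp e)))))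
    agree unit e = h.ε-homo (embed e)
    agree (mul {k} {k′} k∈K k′∈K) e =
      trans (h.∙-homo (k , k∈K) (k′ , k′∈K) (embed e))
        (trans (_≅_.to-cong (proj₁ (transfer (k , k∈K))) (agree k′∈K e))
          (agree k∈K (_≅_.to k′ e)))
    -- By the induction hypothesis at the point `from k e`, `hk` sends that point to `e`; the
    -- inverse of `hk` therefore sends `e` back to it.
    agree (inv {k} k∈K) e = begin
      value (to (proj₁ (transfer (k⁻¹ , inv k∈K))) (embed e))
        ≈⟨ h.⁻¹-homo (k , k∈K) (embed e) ⟩
      value (from hk (embed e))
        ≈⟨ from-cong hk (trans (agree k∈K (from k e)) (Inverse.strictlyInverseˡ (bij k) e)) ⟨
      value (from hk (to hk (embed (from k e))))
        ≈⟨ Inverse.strictlyInverseʳ (bij hk) (embed (from k e)) ⟩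
      value (from k e) ∎
      where
      open import Relation.Binary.Reasoning.Setoid setoid
      open _≅_
      open Element
      k⁻¹ = ≅-sym k
      hk = proj₁ (transfer (k , k∈K))
    agree (eq {k} {k′} k≈k′ k∈K) e =
      trans (h.⟦⟧-cong {k′ , eq k≈k′ k∈K} {k , k∈K} (A₁.sym {k} {k′} k≈k′) (embed e))
        (trans (agree k∈K e) (k≈k′ e))

module Tower {L : Language} (U : Structure {L}) (countable : IsCountable (Structure.setoid U))
  (ultraextensive : Ultraextensive U) where
  open Structure U
  open Setoid setoid using (trans)
  open FiniteSubsets U

  _≟_ : Decidable _≈_
  _≟_ = countable⇒≟ setoid countable

  batch : ℕ → List Carrier
  batch = proj₁ (countable⇒exhausted-by-lists setoid countable)

  -- Minimality is carried along because `coherent-extension` continues only from minimal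
  -- extensions.
  record Stage : Set₁ where
    field
      {C D}     : Subset U
      C-finite  : IsFiniteStructure (U ↾ C)
      D-finite  : IsFiniteStructure (U ↾ D)
      extension : HLExtension C D
      minimal   : IsMinimal extension
    open HLExtension extension public

  record Successor (s : Stage) (xs : List Carrier) : Set₁ where
    private module s = Stage s
    field
      next : Stage
    private module t = Stage next
    field
      D⊆C      : s.D ⊆ t.C
      listed⊆C : listed xs ⊆ t.C
      {C⊆C}    : s.C ⊆ t.C
      coherent : Coherent C⊆C s.extension t.extension

  successor : ∀ s xs → Successor s xs
  successor s xs
    with ds , D⊆ds ← finite⇒⊆listed (Stage.D s) (Stage.D-finite s)
    with D′ , D′-finite , E′ , E′-minimal , E′-coherent ←
      Ultraextensive.coherent-extension ultraextensive
        (Stage.C s) (listed (ds ++ xs)) (Stage.D s)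
        (Stage.C-finite s) (listed-finite _≟_ (ds ++ xs))
        (∈-++⁺ˡ setoid ∘ D⊆ds ∘ Stage.C⊆D s)
        (Stage.D-finite s) (Stage.extension s) (Stage.minimal s)
    = record
      { next = record
        { C-finite  = listed-finite _≟_ (ds ++ xs)
        ; D-finite  = D′-finite
        ; extension = E′
        ; minimal   = E′-minimal
        }
      ; D⊆C      = ∈-++⁺ˡ setoid ∘ D⊆ds
      ; listed⊆C = ∈-++⁺ʳ setoid ds
      ; coherent = E′-coherent
      }

  stage : ℕ → Stage
  stage zero    = record
    { C-finite = ∅-finite ; D-finite = ∅-finite
    ; extension = ∅-extension ; minimal = ∅-minimal }
  stage (suc n) = Successor.next (successor (stage n) (batch n))

  module stage n = Stage (stage n)
  module link n = Successor (successor (stage n) (batch n))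

  C-suc : ∀ n → stage.C n ⊆ stage.C (suc n)
  C-suc n = link.D⊆C n ∘ stage.C⊆D n

  C-covers : ∀ x → ∃ λ n → x ∈ stage.C n
  C-covers x with n , x∈ ← proj₂ (countable⇒exhausted-by-lists setoid countable) x =
    suc n , link.listed⊆C n x∈

  D-covers : ∀ x → ∃ λ n → x ∈ stage.D n
  D-covers x with n , x∈ ← C-covers x = n , stage.C⊆D n x∈

  open DirectedLimit U stage.D (λ n → Coherent.D₁⊆D₂ (link.coherent n))
    D-covers
    -- This is the subgroup underlying `stage.K n`, so `transfer` has the required type.
    (λ n → ⟨ Aut (U ↾ stage.D n) ⟩
             (λ g → ∃ λ p → Group._≈_ (Aut (U ↾ stage.D n)) g (stage.φ n p)))
    (λ n → transfer (link.coherent n))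
    (λ n → IsGroupMonomorphism.isGroupHomomorphism
             (transfer-isGroupMonomorphism (link.coherent n)))
    (λ n → transfer-extends (link.coherent n))
    public

  partialIso-extends : ∀ n (p : 𝒫 (stage.C n)) → ∃ λ g → Subgroup.pred limit-group g ×
    (∀ x (x∈ : x ∈ 𝒫.dom p) → _≅_.to g x ≈ Element.value (_≅_.to (𝒫.iso p) (elem x x∈)))
  partialIso-extends n p = limit n k , limit-∈ n k , λ x x∈ →
    trans (limit-apply n k (proj₁ φp-extends x∈)) (proj₂ φp-extends x x∈)
    where
    k = stage.φᴷ n p
    φp-extends = stage.φ-extends n p

  limit-group-dense : IsDense U (Subgroup.pred limit-group)
  limit-group-dense =
    extends-partialIsos⇒dense _≟_ stage.C C-suc C-covers limit-group partialIso-extends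

theorem1p6 : (L : Language) → IsFiniteLanguage L →
    (U : Structure {L}) → IsCountable (Structure.setoid U) →
    Ultraextensive U →
    ∃ λ (H : Subgroup (Aut U) (lsuc 0ℓ)) →
    IsDense U (Subgroup.pred H) × LocallyFinite (Subgroup.group H)
theorem1p6 L _ U countable ultraextensive =
  limit-group , limit-group-dense , limit-group-locallyFinite stage.D-finite
  where open Tower U countable ultraextensive
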